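{- Let $\lambda$ be a nonzero real number and let $x,y\in\mathbb{R}$. For every integer $n\ge 0$, $$C_{n,\lambda}(x,y)=\frac{1}{n+1}\left\{\beta_{n+1,\lambda}^{(c)}(x+1,y)-\beta_{n+1,\lambda}^{(c)}(x,y)\right\}$$ and $$S_{n,\lambda}(x,y)=\frac{1}{n+1}\left\{\beta_{n+1,\lambda}^{(s)}(x+1,y)-\beta_{n+1,\lambda}^{(s)}(x,y)\right\}.$$
   Context: All generating functions are power series in $t$ around $t=0$. For nonzero $\lambda\in\mathbb{R}$ and complex $z$, the degenerate exponential is $e_\lambda^{z}(t)=(1+\lambda t)^{z/\lambda}$, and $e_\lambda(t)=e_\lambda^1(t)$. The degenerate cosine and sine functions are $\cos_\lambda^{(y)}(t)=\frac{e_\lambda^{iy}(t)+e_\lambda^{ -iy}(t)}{2}=\cos\left(\frac{y}{\lambda}\log(1+\lambda t)\right)$ and $\sin_\lambda^{(y)}(t)=\frac{e_\lambda^{iy}(t)-e_\lambda^{ -iy}(t)}{2i}=\sin\left(\frac{y}{\lambda}\log(1+\lambda t)\right)$, with $i=\sqrt{ -1}$. The degenerate cosine-Bernoulli and sine-Bernoulli polynomials are defined by $\frac{t}{e_\lambda(t)-1}e_\lambda^{x}(t)\cos_\lambda^{(y)}(t)=\sum_{n=0}^{\infty}\beta_{n,\lambda}^{(c)}(x,y)\frac{t^n}{n!}$ and $\frac{t}{e_\lambda(t)-1}e_\lambda^{x}(t)\sin_\lambda^{(y)}(t)=\sum_{n=0}^{\infty}\beta_{n,\lambda}^{(s)}(x,y)\frac{t^n}{n!}$.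 The degenerate cosine-polynomials and sine-polynomials are defined by $e_\lambda^{x}(t)\cos_\lambda^{(y)}(t)=\sum_{n=0}^{\infty}C_{n,\lambda}(x,y)\frac{t^n}{n!}$ and $e_\lambda^{x}(t)\sin_\lambda^{(y)}(t)=\sum_{n=0}^{\infty}S_{n,\lambda}(x,y)\frac{t^n}{n!}$. -}

module Defs where

open import Algebra.Bundles using (CommutativeRing; Semiring)
import Algebra.Definitions.RawMonoid as RawMonoidDefinitions
import Algebra.Definitions.RawSemiring as RawSemiringDefinitions
open import Algebra.Structures using (IsCommutativeRing)
import Data.Integer as ℤ
open import Data.Fin using (toℕ)
open import Data.Nat as ℕ using (ℕ; zero; suc; _!)
import Data.Nat.Properties as ℕ
open import Data.Nat.Properties using (_!≢0)
open import Data.Product using (∃-syntax; _×_; _,_)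
open import Data.Rational as ℚ using (ℚ; 0ℚ; 1ℚ; ½; ∣_∣)
import Data.Rational.Properties as ℚ
open import Data.Rational.Solver using (module +-*-Solver)
open import Level using (0ℓ)
open import Relation.Binary.PropositionalEquality
  using (_≡_; _≢_; refl; sym; trans; cong; cong₂; subst)
open import Relation.Nullary using (yes; no; contradiction)

------------------------------------------------------------------------
-- Real numbers: Cauchy sequences of rationals modulo null sequences

Eventually : (ℕ → Set) → Set
Eventually P = ∃[ N ] (∀ n → N ℕ.≤ n → P n)

IsCauchy : (ℕ → ℚ) → Set
IsCauchy s = ∀ ε → 0ℚ ℚ.< ε →
  ∃[ N ] (∀ m n → N ℕ.≤ m → N ℕ.≤ n → ∣ s m ℚ.- s n ∣ ℚ.≤ ε)

IsNull : (ℕ → ℚ) → Set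
IsNull s = ∀ ε → 0ℚ ℚ.< ε → Eventually (λ n → ∣ s n ∣ ℚ.≤ ε)

record ℝ : Set where
  constructor mkℝ
  field
    seq    : ℕ → ℚ
    cauchy : IsCauchy seq

open ℝ public

infix 4 _≈ᴿ_ _#ᴿ_

record _≈ᴿ_ (x y : ℝ) : Set where
  constructor mk≈
  field
    null : IsNull (λ n → seq x n ℚ.- seq y n)

open _≈ᴿ_ public

-- Apartness, the constructive reading of "x ≠ y": the distance between x
-- and y has a positive rational lower bound.
_#ᴿ_ : ℝ → ℝ → Set
x #ᴿ y = ∃[ ε ] (0ℚ ℚ.< ε × Eventually (λ n → ε ℚ.≤ ∣ seq x n ℚ.- seq y n ∣))

private
  open +-*-Solver using (solve; _:+_; _:*_; _:-_; :-_; _:=_; con)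

  half-pos : ∀ {ε} → 0ℚ ℚ.< ε → 0ℚ ℚ.< ½ ℚ.* ε
  half-pos {ε} p = ℚ.positive⁻¹ (½ ℚ.* ε)
    {{ℚ.pos*pos⇒pos ½ ε {{ℚ.positive p}}}}

  half+half : ∀ ε → ½ ℚ.* ε ℚ.+ ½ ℚ.* ε ≡ ε
  half+half = solve 1 (λ e → con ½ :* e :+ con ½ :* e := e) refl

  -- given B, ε > 0, some δ > 0 with B * δ = ε
  split : ∀ {B ε} → 0ℚ ℚ.< B → 0ℚ ℚ.< ε → ∃[ δ ] (0ℚ ℚ.< δ × B ℚ.* δ ≡ ε)
  split {B} {ε} pB pε = δ , pδ , eq
    where
    instance
      B>0 : ℚ.Positive B
      B>0 = ℚ.positive pB
      B≢0 : ℚ.NonZero B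
      B≢0 = ℚ.pos⇒nonZero B
    δ = (ℚ.1/ B) ℚ.* ε
    pδ = ℚ.positive⁻¹ δ {{ℚ.pos*pos⇒pos (ℚ.1/ B) {{ℚ.1/pos⇒pos B}} ε {{ℚ.positive pε}}}}
    eq : B ℚ.* ((ℚ.1/ B) ℚ.* ε) ≡ ε
    eq = trans (sym (ℚ.*-assoc B (ℚ.1/ B) ε))
           (trans (cong (ℚ._* ε) (ℚ.*-inverseʳ B)) (ℚ.*-identityˡ ε))

  prod-bound : ∀ {a b B δ} → ∣ a ∣ ℚ.≤ B → ∣ b ∣ ℚ.≤ δ → ∣ a ℚ.* b ∣ ℚ.≤ B ℚ.* δ
  prod-bound {a} {b} {B} {δ} p q = begin
    ∣ a ℚ.* b ∣       ≡⟨ ℚ.∣p*q∣≡∣p∣*∣q∣ a b ⟩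
    ∣ a ∣ ℚ.* ∣ b ∣   ≤⟨ ℚ.*-monoʳ-≤-nonNeg ∣ b ∣ {{ℚ.∣-∣-nonNeg b}} p ⟩
    B ℚ.* ∣ b ∣       ≤⟨ ℚ.*-monoˡ-≤-nonNeg B {{ℚ.nonNegative (ℚ.≤-trans (ℚ.0≤∣p∣ a) p)}} q ⟩
    B ℚ.* δ           ∎
    where open ℚ.≤-Reasoning

  sum-bound : ∀ {a b ε} → ∣ a ∣ ℚ.≤ ½ ℚ.* ε → ∣ b ∣ ℚ.≤ ½ ℚ.* ε → ∣ a ℚ.+ b ∣ ℚ.≤ ε
  sum-bound {a} {b} {ε} p q = begin
    ∣ a ℚ.+ b ∣          ≤⟨ ℚ.∣p+q∣≤∣p∣+∣q∣ a b ⟩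
    ∣ a ∣ ℚ.+ ∣ b ∣      ≤⟨ ℚ.+-mono-≤ p q ⟩
    ½ ℚ.* ε ℚ.+ ½ ℚ.* ε  ≡⟨ half+half ε ⟩
    ε                    ∎
    where open ℚ.≤-Reasoning

  flip-abs : ∀ {a b ε} → ∣ a ℚ.- b ∣ ℚ.≤ ε → ∣ b ℚ.- a ∣ ℚ.≤ ε
  flip-abs {a} {b} {ε} = subst (ℚ._≤ ε) (trans (sym (ℚ.∣-p∣≡∣p∣ (a ℚ.- b)))
    (cong ∣_∣ (solve 2 (λ a b → :- (a :- b) := b :- a) refl a b)))

  ⊔ˡ : ∀ {M N n} → M ℕ.⊔ N ℕ.≤ n → M ℕ.≤ n
  ⊔ˡ {M} {N} = ℕ.m⊔n≤o⇒m≤o M N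

  ⊔ʳ : ∀ {M N n} → M ℕ.⊔ N ℕ.≤ n → N ℕ.≤ n
  ⊔ʳ {M} {N} = ℕ.m⊔n≤o⇒n≤o M N

  bounded : ∀ {s} → IsCauchy s → ∃[ B ] (0ℚ ℚ.< B × Eventually (λ n → ∣ s n ∣ ℚ.≤ B))
  bounded {s} c with c 1ℚ (ℚ.positive⁻¹ 1ℚ)
  ... | N , h = ∣ s N ∣ ℚ.+ 1ℚ , pos , N , bound
    where
    pos : 0ℚ ℚ.< ∣ s N ∣ ℚ.+ 1ℚ
    pos = ℚ.+-mono-≤-< (ℚ.0≤∣p∣ (s N)) (ℚ.positive⁻¹ 1ℚ)
    bound : ∀ n → N ℕ.≤ n → ∣ s n ∣ ℚ.≤ ∣ s N ∣ ℚ.+ 1ℚ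
    bound n p = begin
      ∣ s n ∣                           ≡⟨ cong ∣_∣ (solve 2 (λ a b → a := b :+ (a :- b)) refl (s n) (s N)) ⟩
      ∣ s N ℚ.+ (s n ℚ.- s N) ∣         ≤⟨ ℚ.∣p+q∣≤∣p∣+∣q∣ (s N) (s n ℚ.- s N) ⟩
      ∣ s N ∣ ℚ.+ ∣ s n ℚ.- s N ∣       ≤⟨ ℚ.+-monoʳ-≤ ∣ s N ∣ (h n N p ℕ.≤-refl) ⟩
      ∣ s N ∣ ℚ.+ 1ℚ                    ∎
      where open ℚ.≤-Reasoning

  null-≗0 : ∀ {s} → (∀ n → s n ≡ 0ℚ) → IsNull s
  null-≗0 h ε p = 0 , λ n _ → subst (λ q → ∣ q ∣ ℚ.≤ ε) (sym (h n)) (ℚ.<⇒≤ p)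

abstract
  ≗⇒≈ᴿ : ∀ {x y} → (∀ n → seq x n ≡ seq y n) → x ≈ᴿ y
  ≗⇒≈ᴿ {x} {y} h = mk≈ (null-≗0 λ n →
    trans (cong (ℚ._- seq y n) (h n)) (ℚ.+-inverseʳ (seq y n)))

  ≈ᴿ-refl : ∀ {x} → x ≈ᴿ x
  ≈ᴿ-refl = ≗⇒≈ᴿ λ _ → refl

  ≈ᴿ-sym : ∀ {x y} → x ≈ᴿ y → y ≈ᴿ x
  ≈ᴿ-sym {x} {y} (mk≈ h) = mk≈ λ ε p → let N , g = h ε p in N , λ n q → flip-abs {seq x n} {seq y n} (g n q)

  ≈ᴿ-trans : ∀ {x y z} → x ≈ᴿ y → y ≈ᴿ z → x ≈ᴿ z
  ≈ᴿ-trans {x} {y} {z} (mk≈ h) (mk≈ k) = mk≈ λ ε p →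
    let M , f = h (½ ℚ.* ε) (half-pos p)
        N , g = k (½ ℚ.* ε) (half-pos p)
    in M ℕ.⊔ N , λ n q → subst (λ r → ∣ r ∣ ℚ.≤ ε)
         (solve 3 (λ a b c → (a :- b) :+ (b :- c) := a :- c) refl (seq x n) (seq y n) (seq z n))
         (sum-bound (f n (⊔ˡ q)) (g n (⊔ʳ {M} q)))

private
  diff-+ : ∀ a b c d → (a ℚ.- c) ℚ.+ (b ℚ.- d) ≡ (a ℚ.+ b) ℚ.- (c ℚ.+ d)
  diff-+ = solve 4 (λ a b c d → (a :- c) :+ (b :- d) := (a :+ b) :- (c :+ d)) refl

  diff-neg : ∀ a b → b ℚ.- a ≡ (ℚ.- a) ℚ.- (ℚ.- b)
  diff-neg = solve 2 (λ a b → b :- a := (:- a) :- (:- b)) refl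

  diff-* : ∀ a b c d → a ℚ.* (b ℚ.- d) ℚ.+ d ℚ.* (a ℚ.- c) ≡ (a ℚ.* b) ℚ.- (c ℚ.* d)
  diff-* = solve 4 (λ a b c d → a :* (b :- d) :+ d :* (a :- c) := (a :* b) :- (c :* d)) refl

abstract
  const-cauchy : ∀ q → IsCauchy (λ _ → q)
  const-cauchy q ε p = 0 , λ _ _ _ _ →
    subst (λ r → ∣ r ∣ ℚ.≤ ε) (sym (ℚ.+-inverseʳ q)) (ℚ.<⇒≤ p)

  +-cauchy : ∀ {s t} → IsCauchy s → IsCauchy t → IsCauchy (λ n → s n ℚ.+ t n)
  +-cauchy {s} {t} cs ct ε p =
    let M , f = cs (½ ℚ.* ε) (half-pos p)
        N , g = ct (½ ℚ.* ε) (half-pos p)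
    in M ℕ.⊔ N , λ m n q r → subst (λ u → ∣ u ∣ ℚ.≤ ε)
         (diff-+ (s m) (t m) (s n) (t n))
         (sum-bound (f m n (⊔ˡ q) (⊔ˡ r)) (g m n (⊔ʳ {M} q) (⊔ʳ {M} r)))

  neg-cauchy : ∀ {s} → IsCauchy s → IsCauchy (λ n → ℚ.- s n)
  neg-cauchy {s} cs ε p =
    let N , f = cs ε p
    in N , λ m n q r → subst (λ u → ∣ u ∣ ℚ.≤ ε) (diff-neg (s m) (s n)) (f n m r q)

  *-cauchy : ∀ {s t} → IsCauchy s → IsCauchy t → IsCauchy (λ n → s n ℚ.* t n)
  *-cauchy {s} {t} cs ct ε p =
    let Bs , ps , K , ks = bounded {s} cs
        Bt , pt , L , lt = bounded {t} ct
        δ₁ , p₁ , e₁ = split ps (half-pos p)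
        δ₂ , p₂ , e₂ = split pt (half-pos p)
        M , f = ct δ₁ p₁
        N , g = cs δ₂ p₂
    in (K ℕ.⊔ L) ℕ.⊔ (M ℕ.⊔ N) , λ m n q r → subst (λ u → ∣ u ∣ ℚ.≤ ε)
         (diff-* (s m) (t m) (s n) (t n))
         (sum-bound {_} {_} {ε}
           (subst (λ u → ∣ s m ℚ.* (t m ℚ.- t n) ∣ ℚ.≤ u) e₁
             (prod-bound {s m} {t m ℚ.- t n} (ks m (⊔ˡ (⊔ˡ q)))
                (f m n (⊔ˡ (⊔ʳ {K ℕ.⊔ L} q)) (⊔ˡ (⊔ʳ {K ℕ.⊔ L} r)))))
           (subst (λ u → ∣ t n ℚ.* (s m ℚ.- s n) ∣ ℚ.≤ u) e₂
             (prod-bound {t n} {s m ℚ.- s n} (lt n (⊔ʳ {K} (⊔ˡ r)))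
                (g m n (⊔ʳ {M} (⊔ʳ {K ℕ.⊔ L} q)) (⊔ʳ {M} (⊔ʳ {K ℕ.⊔ L} r))))))

infixl 6 _+ᴿ_
infixl 7 _*ᴿ_
infix  8 -ᴿ_

-- The operations on ℝ and ℂ are opaque only to keep unification fast.
opaque
  fromℚ : ℚ → ℝ
  fromℚ q = mkℝ (λ _ → q) (const-cauchy q)

  _+ᴿ_ _*ᴿ_ : ℝ → ℝ → ℝ
  x +ᴿ y = mkℝ (λ n → seq x n ℚ.+ seq y n) (+-cauchy {seq x} {seq y} (cauchy x) (cauchy y))
  x *ᴿ y = mkℝ (λ n → seq x n ℚ.* seq y n) (*-cauchy {seq x} {seq y} (cauchy x) (cauchy y))

  -ᴿ_ : ℝ → ℝ
  -ᴿ x = mkℝ (λ n → ℚ.- seq x n) (neg-cauchy {seq x} (cauchy x))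

0ᴿ 1ᴿ : ℝ
0ᴿ = fromℚ 0ℚ
1ᴿ = fromℚ 1ℚ

opaque
  unfolding fromℚ

  +ᴿ-cong : ∀ {x u y v} → x ≈ᴿ u → y ≈ᴿ v → x +ᴿ y ≈ᴿ u +ᴿ v
  +ᴿ-cong {x} {u} {y} {v} (mk≈ h) (mk≈ k) = mk≈ λ ε p →
    let M , f = h (½ ℚ.* ε) (half-pos p)
        N , g = k (½ ℚ.* ε) (half-pos p)
    in M ℕ.⊔ N , λ n q → subst (λ r → ∣ r ∣ ℚ.≤ ε)
         (diff-+ (seq x n) (seq y n) (seq u n) (seq v n))
         (sum-bound (f n (⊔ˡ q)) (g n (⊔ʳ {M} q)))

  -ᴿ-cong : ∀ {x y} → x ≈ᴿ y → -ᴿ x ≈ᴿ -ᴿ y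
  -ᴿ-cong {x} {y} (mk≈ h) = mk≈ λ ε p →
    let N , f = h ε p
    in N , λ n q → subst (λ r → ∣ r ∣ ℚ.≤ ε)
         (diff-neg (seq x n) (seq y n)) (flip-abs {seq x n} {seq y n} (f n q))

  *ᴿ-cong : ∀ {x u y v} → x ≈ᴿ u → y ≈ᴿ v → x *ᴿ y ≈ᴿ u *ᴿ v
  *ᴿ-cong {x} {u} {y} {v} (mk≈ h) (mk≈ k) = mk≈ λ ε p →
    let Bx , px , K , kx = bounded {seq x} (cauchy x)
        Bv , pv , L , lv = bounded {seq v} (cauchy v)
        δ₁ , p₁ , e₁ = split px (half-pos p)
        δ₂ , p₂ , e₂ = split pv (half-pos p)
        M , f = k δ₁ p₁
        N , g = h δ₂ p₂
    in (K ℕ.⊔ L) ℕ.⊔ (M ℕ.⊔ N) , λ n q → subst (λ r → ∣ r ∣ ℚ.≤ ε)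
         (diff-* (seq x n) (seq y n) (seq u n) (seq v n))
         (sum-bound {_} {_} {ε}
           (subst (λ r → ∣ seq x n ℚ.* (seq y n ℚ.- seq v n) ∣ ℚ.≤ r) e₁
             (prod-bound {seq x n} {seq y n ℚ.- seq v n} (kx n (⊔ˡ (⊔ˡ q))) (f n (⊔ˡ (⊔ʳ {K ℕ.⊔ L} q)))))
           (subst (λ r → ∣ seq v n ℚ.* (seq x n ℚ.- seq u n) ∣ ℚ.≤ r) e₂
             (prod-bound {seq v n} {seq x n ℚ.- seq u n} (lv n (⊔ʳ {K} (⊔ˡ q))) (g n (⊔ʳ {M} (⊔ʳ {K ℕ.⊔ L} q))))))

opaque
  unfolding fromℚ

  ℝ-isCommutativeRing : IsCommutativeRing _≈ᴿ_ _+ᴿ_ _*ᴿ_ -ᴿ_ 0ᴿ 1ᴿ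
  ℝ-isCommutativeRing = record
    { isRing = record
      { +-isAbelianGroup = record
        { isGroup = record
          { isMonoid = record
            { isSemigroup = record
              { isMagma = record
                { isEquivalence = record
                  { refl = ≈ᴿ-refl ; sym = ≈ᴿ-sym ; trans = ≈ᴿ-trans }
                ; ∙-cong = +ᴿ-cong
                }
              ; assoc = λ x y z → ≗⇒≈ᴿ λ n → ℚ.+-assoc (seq x n) (seq y n) (seq z n)
              }
            ; identity = (λ x → ≗⇒≈ᴿ λ n → ℚ.+-identityˡ (seq x n))
                       , (λ x → ≗⇒≈ᴿ λ n → ℚ.+-identityʳ (seq x n))
            }
          ; inverse = (λ x → ≗⇒≈ᴿ λ n → ℚ.+-inverseˡ (seq x n))
                    , (λ x → ≗⇒≈ᴿ λ n → ℚ.+-inverseʳ (seq x n))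
          ; ⁻¹-cong = -ᴿ-cong
          }
        ; comm = λ x y → ≗⇒≈ᴿ λ n → ℚ.+-comm (seq x n) (seq y n)
        }
      ; *-cong = *ᴿ-cong
      ; *-assoc = λ x y z → ≗⇒≈ᴿ λ n → ℚ.*-assoc (seq x n) (seq y n) (seq z n)
      ; *-identity = (λ x → ≗⇒≈ᴿ λ n → ℚ.*-identityˡ (seq x n))
                   , (λ x → ≗⇒≈ᴿ λ n → ℚ.*-identityʳ (seq x n))
      ; distrib = (λ x y z → ≗⇒≈ᴿ λ n → ℚ.*-distribˡ-+ (seq x n) (seq y n) (seq z n))
                , (λ x y z → ≗⇒≈ᴿ λ n → ℚ.*-distribʳ-+ (seq x n) (seq y n) (seq z n))
      }
    ; *-comm = λ x y → ≗⇒≈ᴿ λ n → ℚ.*-comm (seq x n) (seq y n)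
    }

ℝ-commutativeRing : CommutativeRing 0ℓ 0ℓ
ℝ-commutativeRing = record { isCommutativeRing = ℝ-isCommutativeRing }

-- The value at 0 is irrelevant: a sequence representing a real apart from 0
-- has only finitely many zero terms.
recipℚ : ℚ → ℚ
recipℚ q with q ℚ.≟ 0ℚ
... | yes _   = 0ℚ
... | no  q≢0 = (ℚ.1/ q) {{ℚ.≢-nonZero q≢0}}

private
  recipℚ-inverseʳ : ∀ q → q ≢ 0ℚ → q ℚ.* recipℚ q ≡ 1ℚ
  recipℚ-inverseʳ q h with q ℚ.≟ 0ℚ
  ... | yes e   = contradiction e h
  ... | no  q≢0 = ℚ.*-inverseʳ q {{ℚ.≢-nonZero q≢0}}

  apart⇒≢0 : ∀ {ε} → 0ℚ ℚ.< ε → ∀ q → ε ℚ.≤ ∣ q ℚ.- 0ℚ ∣ → q ≢ 0ℚ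
  apart⇒≢0 p q h refl = ℚ.<-irrefl refl (ℚ.<-≤-trans p h)

  recipℚ-bound : ∀ {ε B} → 0ℚ ℚ.< ε → ε ℚ.* B ≡ 1ℚ →
                 ∀ q → ε ℚ.≤ ∣ q ℚ.- 0ℚ ∣ → ∣ recipℚ q ∣ ℚ.≤ B
  recipℚ-bound {ε} {B} p e q h = ℚ.*-cancelˡ-≤-pos ε {{ℚ.positive p}} (begin
    ε ℚ.* ∣ recipℚ q ∣      ≤⟨ ℚ.*-monoʳ-≤-nonNeg ∣ recipℚ q ∣ {{ℚ.∣-∣-nonNeg (recipℚ q)}}
                                 (subst (λ r → ε ℚ.≤ ∣ r ∣) (ℚ.+-identityʳ q) h) ⟩
    ∣ q ∣ ℚ.* ∣ recipℚ q ∣  ≡⟨ sym (ℚ.∣p*q∣≡∣p∣*∣q∣ q (recipℚ q)) ⟩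
    ∣ q ℚ.* recipℚ q ∣      ≡⟨ cong ∣_∣ (recipℚ-inverseʳ q (apart⇒≢0 p q h)) ⟩
    1ℚ                      ≡⟨ sym e ⟩
    ε ℚ.* B                 ∎)
    where open ℚ.≤-Reasoning

  recipℚ-diff : ∀ a b → a ≢ 0ℚ → b ≢ 0ℚ →
    recipℚ a ℚ.* (recipℚ b ℚ.* (b ℚ.- a)) ≡ recipℚ a ℚ.- recipℚ b
  recipℚ-diff a b ha hb = trans
    (solve 4 (λ a b r s → r :* (s :* (b :- a)) := r :* (b :* s) :- s :* (a :* r))
       refl a b (recipℚ a) (recipℚ b))
    (cong₂ ℚ._-_
      (trans (cong (recipℚ a ℚ.*_) (recipℚ-inverseʳ b hb)) (ℚ.*-identityʳ (recipℚ a)))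
      (trans (cong (recipℚ b ℚ.*_) (recipℚ-inverseʳ a ha)) (ℚ.*-identityʳ (recipℚ b))))

abstract
  recip-cauchy : ∀ {s η K} → 0ℚ ℚ.< η → (∀ n → K ℕ.≤ n → η ℚ.≤ ∣ s n ℚ.- 0ℚ ∣) →
                 IsCauchy s → IsCauchy (λ n → recipℚ (s n))
  recip-cauchy {s} {η} {K} pη k cs ε p =
    let B  , pB , e  = split pη (ℚ.positive⁻¹ 1ℚ)
        δ₁ , p₁ , e₁ = split pB p
        δ₂ , p₂ , e₂ = split pB p₁
        N , f = cs δ₂ p₂
    in K ℕ.⊔ N , λ m n q r → subst (λ u → ∣ u ∣ ℚ.≤ ε)
         (recipℚ-diff (s m) (s n)
           (apart⇒≢0 pη (s m) (k m (⊔ˡ q))) (apart⇒≢0 pη (s n) (k n (⊔ˡ r))))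
         (subst (λ u → ∣ recipℚ (s m) ℚ.* (recipℚ (s n) ℚ.* (s n ℚ.- s m)) ∣ ℚ.≤ u)
           (trans (cong (B ℚ.*_) e₂) e₁)
           (prod-bound {recipℚ (s m)} (recipℚ-bound pη e (s m) (k m (⊔ˡ q)))
             (prod-bound {recipℚ (s n)} {s n ℚ.- s m} (recipℚ-bound pη e (s n) (k n (⊔ˡ r)))
               (f n m (⊔ʳ {K} r) (⊔ʳ {K} q)))))

opaque
  unfolding fromℚ

  recipᴿ : (x : ℝ) → x #ᴿ 0ᴿ → ℝ
  recipᴿ x (η , η>0 , K , k) =
    mkℝ (λ n → recipℚ (seq x n)) (recip-cauchy {seq x} η>0 k (cauchy x))

opaque
  unfolding recipᴿ

  recipᴿ-inverseʳ : ∀ x (x#0 : x #ᴿ 0ᴿ) → x *ᴿ recipᴿ x x#0 ≈ᴿ 1ᴿ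
  recipᴿ-inverseʳ x (η , pη , K , k) = mk≈ λ ε p → K , λ n q →
    subst (λ u → ∣ u ℚ.- 1ℚ ∣ ℚ.≤ ε)
      (sym (recipℚ-inverseʳ (seq x n) (apart⇒≢0 pη (seq x n) (k n q)))) (ℚ.<⇒≤ p)

------------------------------------------------------------------------
-- Complex numbers

infix 5 _+i_
infix 4 _≈ᶜ_ _+i≈_

record ℂ : Set where
  constructor _+i_
  field
    re im : ℝ

open ℂ public

record _≈ᶜ_ (z w : ℂ) : Set where
  constructor _+i≈_
  field
    re≈ : re z ≈ᴿ re w
    im≈ : im z ≈ᴿ im w

open _≈ᶜ_ public

infixl 6 _+ᶜ_
infixl 7 _*ᶜ_
infix  8 -ᶜ_

opaque
  _+ᶜ_ _*ᶜ_ : ℂ → ℂ → ℂ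
  z +ᶜ w = re z +ᴿ re w +i im z +ᴿ im w
  z *ᶜ w = re z *ᴿ re w +ᴿ -ᴿ (im z *ᴿ im w) +i re z *ᴿ im w +ᴿ im z *ᴿ re w

  -ᶜ_ : ℂ → ℂ
  -ᶜ z = -ᴿ re z +i -ᴿ im z

ofℝ : ℝ → ℂ
ofℝ x = x +i 0ᴿ

ofℚ : ℚ → ℂ
ofℚ q = ofℝ (fromℚ q)

ofℕ : ℕ → ℂ
ofℕ n = ofℚ (ℤ.+ n ℚ./ 1)

1/ofℕ : (n : ℕ) .{{_ : ℕ.NonZero n}} → ℂ
1/ofℕ n = ofℚ (ℤ.+ 1 ℚ./ n)

0ᶜ 1ᶜ 𝕚 1/2𝕚 : ℂ
0ᶜ   = ofℝ 0ᴿ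
1ᶜ   = ofℝ 1ᴿ
𝕚    = 0ᴿ +i 1ᴿ
1/2𝕚 = -ᶜ (ofℚ ½ *ᶜ 𝕚)  -- 1/(2i) = - i/2

private
  ≗⇒≈ᶜ : ∀ {z w} → (∀ n → seq (re z) n ≡ seq (re w) n) →
         (∀ n → seq (im z) n ≡ seq (im w) n) → z ≈ᶜ w
  ≗⇒≈ᶜ h k = ≗⇒≈ᴿ h +i≈ ≗⇒≈ᴿ k

  ≈ᶜ-trans : ∀ {u v w} → u ≈ᶜ v → v ≈ᶜ w → u ≈ᶜ w
  ≈ᶜ-trans (p +i≈ q) (r +i≈ s) = ≈ᴿ-trans p r +i≈ ≈ᴿ-trans q s

  opaque
    unfolding fromℚ _+ᶜ_

    +ᶜ-cong : ∀ {u v w z} → u ≈ᶜ v → w ≈ᶜ z → u +ᶜ w ≈ᶜ v +ᶜ z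
    +ᶜ-cong (p +i≈ q) (r +i≈ s) = +ᴿ-cong p r +i≈ +ᴿ-cong q s

    *ᶜ-assoc : ∀ z w v → (z *ᶜ w) *ᶜ v ≈ᶜ z *ᶜ (w *ᶜ v)
    *ᶜ-assoc z w v = ≗⇒≈ᶜ
      (λ n → solve 6 (λ a b c d e f →
         (a :* c :+ :- (b :* d)) :* e :+ :- ((a :* d :+ b :* c) :* f)
         := a :* (c :* e :+ :- (d :* f)) :+ :- (b :* (c :* f :+ d :* e))) refl
         (seq (re z) n) (seq (im z) n) (seq (re w) n) (seq (im w) n) (seq (re v) n) (seq (im v) n))
      (λ n → solve 6 (λ a b c d e f →
         (a :* c :+ :- (b :* d)) :* f :+ (a :* d :+ b :* c) :* e
         := a :* (c :* f :+ d :* e) :+ b :* (c :* e :+ :- (d :* f))) refl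
         (seq (re z) n) (seq (im z) n) (seq (re w) n) (seq (im w) n) (seq (re v) n) (seq (im v) n))

    *ᶜ-comm : ∀ z w → z *ᶜ w ≈ᶜ w *ᶜ z
    *ᶜ-comm z w = ≗⇒≈ᶜ
      (λ n → solve 4 (λ a b c d → a :* c :+ :- (b :* d) := c :* a :+ :- (d :* b)) refl
         (seq (re z) n) (seq (im z) n) (seq (re w) n) (seq (im w) n))
      (λ n → solve 4 (λ a b c d → a :* d :+ b :* c := c :* b :+ d :* a) refl
         (seq (re z) n) (seq (im z) n) (seq (re w) n) (seq (im w) n))

    *ᶜ-identityˡ : ∀ z → 1ᶜ *ᶜ z ≈ᶜ z
    *ᶜ-identityˡ z = ≗⇒≈ᶜ
      (λ n → solve 2 (λ a b → con 1ℚ :* a :+ :- (con 0ℚ :* b) := a) refl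
         (seq (re z) n) (seq (im z) n))
      (λ n → solve 2 (λ a b → con 1ℚ :* b :+ con 0ℚ :* a := b) refl
         (seq (re z) n) (seq (im z) n))

    *ᶜ-distribˡ : ∀ z w v → z *ᶜ (w +ᶜ v) ≈ᶜ z *ᶜ w +ᶜ z *ᶜ v
    *ᶜ-distribˡ z w v = ≗⇒≈ᶜ
      (λ n → solve 6 (λ a b c d e f →
         a :* (c :+ e) :+ :- (b :* (d :+ f))
         := (a :* c :+ :- (b :* d)) :+ (a :* e :+ :- (b :* f))) refl
         (seq (re z) n) (seq (im z) n) (seq (re w) n) (seq (im w) n) (seq (re v) n) (seq (im v) n))
      (λ n → solve 6 (λ a b c d e f →
         a :* (d :+ f) :+ b :* (c :+ e)
         := (a :* d :+ b :* c) :+ (a :* f :+ b :* e)) refl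
         (seq (re z) n) (seq (im z) n) (seq (re w) n) (seq (im w) n) (seq (re v) n) (seq (im v) n))

  module Rᴿ = CommutativeRing ℝ-commutativeRing

opaque
  unfolding _+ᶜ_

  ℂ-isCommutativeRing : IsCommutativeRing _≈ᶜ_ _+ᶜ_ _*ᶜ_ -ᶜ_ 0ᶜ 1ᶜ
  ℂ-isCommutativeRing = record
    { isRing = record
      { +-isAbelianGroup = record
        { isGroup = record
          { isMonoid = record
            { isSemigroup = record
              { isMagma = record
                { isEquivalence = record
                  { refl  = ≈ᴿ-refl +i≈ ≈ᴿ-refl
                  ; sym   = λ (p +i≈ q) → ≈ᴿ-sym p +i≈ ≈ᴿ-sym q
                  ; trans = ≈ᶜ-trans
                  }
                ; ∙-cong = +ᶜ-cong
                }
              ; assoc = λ z w v → Rᴿ.+-assoc (re z) (re w) (re v) +i≈ Rᴿ.+-assoc (im z) (im w) (im v)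
              }
            ; identity = (λ z → Rᴿ.+-identityˡ (re z) +i≈ Rᴿ.+-identityˡ (im z))
                       , (λ z → Rᴿ.+-identityʳ (re z) +i≈ Rᴿ.+-identityʳ (im z))
            }
          ; inverse = (λ z → Rᴿ.-‿inverseˡ (re z) +i≈ Rᴿ.-‿inverseˡ (im z))
                    , (λ z → Rᴿ.-‿inverseʳ (re z) +i≈ Rᴿ.-‿inverseʳ (im z))
          ; ⁻¹-cong = λ (p +i≈ q) → -ᴿ-cong p +i≈ -ᴿ-cong q
          }
        ; comm = λ z w → Rᴿ.+-comm (re z) (re w) +i≈ Rᴿ.+-comm (im z) (im w)
        }
      ; *-cong = λ (p +i≈ q) (r +i≈ s) →
              +ᴿ-cong (*ᴿ-cong p r) (-ᴿ-cong (*ᴿ-cong q s))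
          +i≈ +ᴿ-cong (*ᴿ-cong p s) (*ᴿ-cong q r)
      ; *-assoc = *ᶜ-assoc
      ; *-identity = *ᶜ-identityˡ
                   , (λ z → ≈ᶜ-trans (*ᶜ-comm z 1ᶜ) (*ᶜ-identityˡ z))
      ; distrib = *ᶜ-distribˡ
                , (λ z w v → ≈ᶜ-trans (*ᶜ-comm (w +ᶜ v) z)
                    (≈ᶜ-trans (*ᶜ-distribˡ z w v) (+ᶜ-cong (*ᶜ-comm z w) (*ᶜ-comm z v))))
      }
    ; *-comm = *ᶜ-comm
    }

ℂ-commutativeRing : CommutativeRing 0ℓ 0ℓ
ℂ-commutativeRing = record { isCommutativeRing = ℂ-isCommutativeRing }

opaque
  unfolding fromℚ _+ᶜ_

  ofℝ-* : ∀ x y → ofℝ x *ᶜ ofℝ y ≈ᶜ ofℝ (x *ᴿ y)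
  ofℝ-* x y = ≗⇒≈ᶜ
    (λ n → solve 2 (λ a b → a :* b :+ :- (con 0ℚ :* con 0ℚ) := a :* b) refl (seq x n) (seq y n))
    (λ n → solve 2 (λ a b → a :* con 0ℚ :+ con 0ℚ :* b := con 0ℚ) refl (seq x n) (seq y n))

  1/2𝕚-inverse : 1/2𝕚 *ᶜ (ofℕ 2 *ᶜ 𝕚) ≈ᶜ 1ᶜ
  1/2𝕚-inverse = ≗⇒≈ᶜ (λ _ → refl) (λ _ → refl)

private module Cℂ = CommutativeRing ℂ-commutativeRing
open Cℂ public using () renaming (_-_ to _-ᶜ_)
open RawSemiringDefinitions (Semiring.rawSemiring Cℂ.semiring) public
  using () renaming (_^_ to _^ᶜ_)

------------------------------------------------------------------------
-- Formal power series over a commutative ring, as coefficient sequences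

module PowerSeries {c ℓ} (R : CommutativeRing c ℓ) where

  private
    open module R = CommutativeRing R using (Carrier; _≈_; _+_; _*_; -_; _-_; 0#; 1#)
    cancel : ∀ a b → a + (b - a) ≈ b
    cancel a b = R.trans (R.+-congˡ (R.+-comm b (- a)))
      (R.trans (R.sym (R.+-assoc a (- a) b))
        (R.trans (R.+-congʳ (R.-‿inverseʳ a)) (R.+-identityˡ b)))

  open RawMonoidDefinitions R.+-rawMonoid using (sum)

  Series : Set c
  Series = ℕ → Carrier

  infix  4 _≋_
  infixl 6 _⊕_ _⊖_
  infixl 7 _⊛_ _·_

  _≋_ : Series → Series → Set ℓ
  f ≋ g = ∀ n → f n ≈ g n

  𝟙 : Series
  𝟙 zero    = 1#
  𝟙 (suc _) = 0#

  _⊕_ _⊖_ _⊛_ : Series → Series → Series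
  (f ⊕ g) n = f n + g n
  (f ⊖ g) n = f n - g n
  (f ⊛ g) n = sum {suc n} (λ k → f (toℕ k) * g (n ℕ.∸ toℕ k))

  _·_ : Carrier → Series → Series
  (a · f) n = a * f n

  t⊛_ : Series → Series
  (t⊛ f) zero    = 0#
  (t⊛ f) (suc n) = f n

  -- (f - f 0) / t
  tail : Series → Series
  tail f n = f (suc n)

  -- f / g by long division: f / g = f 0 + t · (((f - f 0 · g) / t) / g).
  quotient : (f g : Series) → g 0 ≈ 1# → Series
  quotient f g g₀≈1 zero    = f 0
  quotient f g g₀≈1 (suc n) = quotient (tail (f ⊖ (f 0 · g))) g g₀≈1 n

  quotient-⊛ : ∀ f g g₀≈1 → quotient f g g₀≈1 ⊛ g ≋ f
  quotient-⊛ f g g₀≈1 zero =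
    R.trans (R.+-identityʳ _) (R.trans (R.*-congˡ g₀≈1) (R.*-identityʳ _))
  quotient-⊛ f g g₀≈1 (suc n) =
    R.trans (R.+-congˡ (quotient-⊛ (tail (f ⊖ (f 0 · g))) g g₀≈1 n))
            (cancel (f 0 * g (suc n)) (f (suc n)))

  ⊛-tail : ∀ f g → g 0 ≈ 0# → ∀ n → (f ⊛ g) (suc n) ≈ (f ⊛ tail g) n
  ⊛-tail f g g₀≈0 zero =
    R.+-congˡ (R.trans (R.+-identityʳ _) (R.trans (R.*-congˡ g₀≈0) (R.zeroʳ _)))
  ⊛-tail f g g₀≈0 (suc n) = R.+-congˡ (⊛-tail (tail f) g g₀≈0 n)

open PowerSeries ℂ-commutativeRing public

------------------------------------------------------------------------
-- The binomial series

fallingFactorial : ℂ → ℕ → ℂ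
fallingFactorial a zero    = 1ᶜ
fallingFactorial a (suc n) = fallingFactorial a n *ᶜ (a -ᶜ ofℕ n)

binomial : ℂ → ℕ → ℂ
binomial a n = fallingFactorial a n *ᶜ 1/ofℕ (n !) {{n !≢0}}

-- (1 + b t)^a = Σₙ binomial a n · bⁿ tⁿ
[1+_t]^_ : ℂ → ℂ → Series
([1+ b t]^ a) n = binomial a n *ᶜ (b ^ᶜ n)

------------------------------------------------------------------------
-- Degenerate functions and polynomials

module Degenerate (lam : ℝ) (lam#0 : lam #ᴿ 0ᴿ) where

  infixl 7 _/lam
  _/lam : ℂ → ℂ
  z /lam = z *ᶜ ofℝ (recipᴿ lam lam#0)

  exp : ℂ → Series
  exp z = [1+ ofℝ lam t]^ (z /lam)

  cos sin : ℝ → Series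
  cos y = ofℚ ½ · (exp (𝕚 *ᶜ ofℝ y) ⊕ exp (-ᶜ (𝕚 *ᶜ ofℝ y)))
  sin y = 1/2𝕚  · (exp (𝕚 *ᶜ ofℝ y) ⊖ exp (-ᶜ (𝕚 *ᶜ ofℝ y)))

  private
    lam/lam : 1ᶜ /lam *ᶜ ofℝ lam ≈ᶜ 1ᶜ
    lam/lam = Cℂ.trans (Cℂ.*-congʳ (Cℂ.*-identityˡ _)) (Cℂ.trans (Cℂ.*-comm _ _)
      (Cℂ.trans (ofℝ-* lam (recipᴿ lam lam#0))
        (recipᴿ-inverseʳ lam lam#0 +i≈ ≈ᴿ-refl)))

    exp-constant : ∀ z → exp z 0 ≈ᶜ 1ᶜ
    exp-constant z = Cℂ.trans (Cℂ.*-identityʳ _) (Cℂ.*-identityʳ _)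

    exp-linear : exp 1ᶜ 1 ≈ᶜ 1ᶜ
    exp-linear = begin
      1ᶜ *ᶜ (1ᶜ /lam -ᶜ 0ᶜ) *ᶜ 1ᶜ *ᶜ (ofℝ lam *ᶜ 1ᶜ)
        ≈⟨ Cℂ.*-cong (Cℂ.*-identityʳ _) (Cℂ.*-identityʳ _) ⟩
      1ᶜ *ᶜ (1ᶜ /lam -ᶜ 0ᶜ) *ᶜ ofℝ lam
        ≈⟨ Cℂ.*-congʳ (Cℂ.*-identityˡ _) ⟩
      (1ᶜ /lam -ᶜ 0ᶜ) *ᶜ ofℝ lam
        ≈⟨ Cℂ.*-congʳ (Cℂ.trans (Cℂ.+-congˡ ε⁻¹≈ε) (Cℂ.+-identityʳ _)) ⟩
      1ᶜ /lam *ᶜ ofℝ lam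
        ≈⟨ lam/lam ⟩
      1ᶜ ∎
      where
      open import Relation.Binary.Reasoning.Setoid Cℂ.setoid
      open import Algebra.Properties.Group Cℂ.+-group using (ε⁻¹≈ε)

    exp-1-constant : (exp 1ᶜ ⊖ 𝟙) 0 ≈ᶜ 0ᶜ
    exp-1-constant = Cℂ.trans (Cℂ.+-congʳ (exp-constant 1ᶜ)) (Cℂ.-‿inverseʳ 1ᶜ)

  -- (exp 1 - 1) / t, which has constant coefficient 1
  [exp-1]/t : Series
  [exp-1]/t = tail (exp 1ᶜ ⊖ 𝟙)

  [exp-1]/t-const : [exp-1]/t 0 ≈ᶜ 1ᶜ
  [exp-1]/t-const = Cℂ.trans (Cℂ.+-cong exp-linear ε⁻¹≈ε) (Cℂ.+-identityʳ 1ᶜ)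
    where open import Algebra.Properties.Group Cℂ.+-group using (ε⁻¹≈ε)

  t/[exp-1] : Series
  t/[exp-1] = quotient 𝟙 [exp-1]/t [exp-1]/t-const

  t/[exp-1]-⊛ : t/[exp-1] ⊛ (exp 1ᶜ ⊖ 𝟙) ≋ t⊛ 𝟙
  t/[exp-1]-⊛ zero = Cℂ.trans (Cℂ.+-identityʳ _)
    (Cℂ.trans (Cℂ.*-congˡ exp-1-constant) (Cℂ.zeroʳ _))
  t/[exp-1]-⊛ (suc n) = Cℂ.trans
    (⊛-tail t/[exp-1] (exp 1ᶜ ⊖ 𝟙) exp-1-constant n)
    (quotient-⊛ 𝟙 [exp-1]/t [exp-1]/t-const n)

  -- n! times the n-th coefficient
  egfCoefficient : Series → ℕ → ℂ
  egfCoefficient f n = ofℕ (n !) *ᶜ f n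

  C S βᶜ βˢ : ℕ → ℝ → ℝ → ℂ
  C  n x y = egfCoefficient (exp (ofℝ x) ⊛ cos y) n
  S  n x y = egfCoefficient (exp (ofℝ x) ⊛ sin y) n
  βᶜ n x y = egfCoefficient (t/[exp-1] ⊛ exp (ofℝ x) ⊛ cos y) n
  βˢ n x y = egfCoefficient (t/[exp-1] ⊛ exp (ofℝ x) ⊛ sin y) n

{-# OPTIONS --safe #-}
module Submission where

-- Since exp (x + 1) - exp x = exp x · (exp 1 - 1), replacing x by x + 1 in
-- t / (exp 1 - 1) · exp x · h changes this series by t · exp x · h; the theorem
-- compares coefficients for h = cos y and h = sin y.  The addition law
-- (1 + b t)^(a + a′) = (1 + b t)^a · (1 + b t)^a′ holds because both sides have
-- constant term 1 and satisfy (1 + b t) F′ = (a + a′) b F, which determines F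
-- as all positive integers are invertible in ℂ.

open import Algebra.Bundles using (CommutativeRing)
import Algebra.Construct.Pointwise as Pointwise
import Algebra.Properties.Ring as RingProperties
import Algebra.Solver.Ring.NaturalCoefficients.Default as SemiringSolver
import Data.Integer as ℤ
import Data.Integer.Properties as ℤ
open import Data.Nat as ℕ using (ℕ; zero; suc; _!)
open import Data.Nat.Properties using (_!≢0)
open import Data.Product using (_×_; _,_)
open import Data.Rational as ℚ using (1ℚ)
import Data.Rational.Properties as ℚ
open import Data.Rational.Unnormalised as ℚᵘ using (mkℚᵘ; *≡*)
import Data.Rational.Unnormalised.Properties as ℚᵘ
open import Defs using (module PowerSeries)
open import Level using (Level)
open import Relation.Binary.PropositionalEquality
  using (_≡_; refl; sym; trans; cong)
import Relation.Binary.Reasoning.Setoid as SetoidReasoning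

private variable
  c ℓ : Level

-- Formal power series over a commutative ring form a commutative ring.

module PowerSeriesProperties (R : CommutativeRing c ℓ) where

  open CommutativeRing R hiding (zero) renaming (refl to ≈-refl; sym to ≈-sym; trans to ≈-trans)
  open PowerSeries R
  open SemiringSolver commutativeSemiring using (solve; _:+_; _:*_; _:=_)
  open SetoidReasoning setoid

  -- The sum defining `(f ⊛ g) (suc n)` unfolds by computation to
  -- `f 0 * g (suc n) + (tail f ⊛ g) n`. Hence induction on the degree, with the left factor
  -- replaced by its tail, works here and for most of the ring laws below.
  ⊛-cong : ∀ f f′ g g′ → f ≋ f′ → g ≋ g′ → f ⊛ g ≋ f′ ⊛ g′
  ⊛-cong f f′ g g′ p q zero    = +-congʳ (*-cong (p 0) (q 0))
  ⊛-cong f f′ g g′ p q (suc n) =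
    +-cong (*-cong (p 0) (q (suc n))) (⊛-cong (tail f) (tail f′) g g′ (λ k → p (suc k)) q n)

  ⊛-distribʳ : ∀ f g h → (g ⊕ h) ⊛ f ≋ g ⊛ f ⊕ h ⊛ f
  ⊛-distribʳ f g h zero = begin
    (g 0 + h 0) * f 0 + 0#               ≈⟨ +-identityʳ _ ⟩
    (g 0 + h 0) * f 0                    ≈⟨ distribʳ (f 0) (g 0) (h 0) ⟩
    g 0 * f 0 + h 0 * f 0                ≈⟨ +-cong (+-identityʳ _) (+-identityʳ _) ⟨
    (g 0 * f 0 + 0#) + (h 0 * f 0 + 0#)  ∎
  ⊛-distribʳ f g h (suc n) = begin
    (g 0 + h 0) * f (suc n) + ((tail g ⊕ tail h) ⊛ f) n
      ≈⟨ +-congˡ (⊛-distribʳ f (tail g) (tail h) n) ⟩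
    (g 0 + h 0) * f (suc n) + ((tail g ⊛ f) n + (tail h ⊛ f) n)
      ≈⟨ solve 5 (λ a b c x y → (a :+ b) :* c :+ (x :+ y) := (a :* c :+ x) :+ (b :* c :+ y))
           ≈-refl (g 0) (h 0) (f (suc n)) ((tail g ⊛ f) n) ((tail h ⊛ f) n) ⟩
    (g 0 * f (suc n) + (tail g ⊛ f) n) + (h 0 * f (suc n) + (tail h ⊛ f) n) ∎

  ·-⊛ : ∀ a f g → (a · f) ⊛ g ≋ a · (f ⊛ g)
  ·-⊛ a f g zero = begin
    a * f 0 * g 0 + 0#    ≈⟨ +-identityʳ _ ⟩
    a * f 0 * g 0         ≈⟨ *-assoc a (f 0) (g 0) ⟩
    a * (f 0 * g 0)       ≈⟨ *-congˡ (+-identityʳ _) ⟨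
    a * (f 0 * g 0 + 0#)  ∎
  ·-⊛ a f g (suc n) = begin
    a * f 0 * g (suc n) + ((a · tail f) ⊛ g) n
      ≈⟨ +-congˡ (·-⊛ a (tail f) g n) ⟩
    a * f 0 * g (suc n) + a * (tail f ⊛ g) n
      ≈⟨ solve 4 (λ a b c x → a :* b :* c :+ a :* x := a :* (b :* c :+ x))
           ≈-refl a (f 0) (g (suc n)) ((tail f ⊛ g) n) ⟩
    a * (f 0 * g (suc n) + (tail f ⊛ g) n) ∎

  ⊛-assoc : ∀ f g h → (f ⊛ g) ⊛ h ≋ f ⊛ (g ⊛ h)
  ⊛-assoc f g h zero = begin
    (f 0 * g 0 + 0#) * h 0 + 0#  ≈⟨ +-congʳ (*-congʳ (+-identityʳ _)) ⟩
    f 0 * g 0 * h 0 + 0#         ≈⟨ +-congʳ (*-assoc (f 0) (g 0) (h 0)) ⟩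
    f 0 * (g 0 * h 0) + 0#       ≈⟨ +-congʳ (*-congˡ (+-identityʳ _)) ⟨
    f 0 * (g 0 * h 0 + 0#) + 0#  ∎
  ⊛-assoc f g h (suc n) = begin
    -- By computation, `tail (f ⊛ g)` is `f 0 · tail g ⊕ tail f ⊛ g`, which is how distributivity
    -- and scalar multiplication enter.
    (f 0 * g 0 + 0#) * h (suc n) + ((f 0 · tail g ⊕ tail f ⊛ g) ⊛ h) n
      ≈⟨ +-cong (*-congʳ (+-identityʳ _)) (⊛-distribʳ h (f 0 · tail g) (tail f ⊛ g) n) ⟩
    f 0 * g 0 * h (suc n) + (((f 0 · tail g) ⊛ h) n + ((tail f ⊛ g) ⊛ h) n)
      ≈⟨ +-congˡ (+-cong (·-⊛ (f 0) (tail g) h n) (⊛-assoc (tail f) g h n)) ⟩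
    f 0 * g 0 * h (suc n) + (f 0 * (tail g ⊛ h) n + (tail f ⊛ (g ⊛ h)) n)
      ≈⟨ solve 5 (λ a b c x y → a :* b :* c :+ (a :* x :+ y) := a :* (b :* c :+ x) :+ y)
           ≈-refl (f 0) (g 0) (h (suc n)) ((tail g ⊛ h) n) ((tail f ⊛ (g ⊛ h)) n) ⟩
    f 0 * (g 0 * h (suc n) + (tail g ⊛ h) n) + (tail f ⊛ (g ⊛ h)) n ∎

  -- The definition splits off the first coefficient of the left factor. Commutativity also needs
  -- this mirror image, which splits off the first coefficient of the right factor.
  ⊛-last : ∀ f g n → (f ⊛ g) (suc n) ≈ (f ⊛ tail g) n + f (suc n) * g 0
  ⊛-last f g zero = begin
    f 0 * g 1 + (f 1 * g 0 + 0#)  ≈⟨ +-cong (≈-sym (+-identityʳ _)) (+-identityʳ _) ⟩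
    f 0 * g 1 + 0# + f 1 * g 0    ∎
  ⊛-last f g (suc n) = ≈-trans (+-congˡ (⊛-last (tail f) g n)) (≈-sym (+-assoc _ _ _))

  ⊛-comm : ∀ f g → f ⊛ g ≋ g ⊛ f
  ⊛-comm f g zero    = +-congʳ (*-comm (f 0) (g 0))
  ⊛-comm f g (suc n) = begin
    f 0 * g (suc n) + (tail f ⊛ g) n  ≈⟨ +-cong (*-comm _ _) (⊛-comm (tail f) g n) ⟩
    g (suc n) * f 0 + (g ⊛ tail f) n  ≈⟨ +-comm _ _ ⟩
    (g ⊛ tail f) n + g (suc n) * f 0  ≈⟨ ⊛-last g f n ⟨
    (g ⊛ f) (suc n)                   ∎

  ⊛-zeroˡ : ∀ f → (λ _ → 0#) ⊛ f ≋ λ _ → 0#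
  ⊛-zeroˡ f zero    = ≈-trans (+-identityʳ _) (zeroˡ _)
  ⊛-zeroˡ f (suc n) = ≈-trans (+-cong (zeroˡ _) (⊛-zeroˡ f n)) (+-identityˡ _)

  ⊛-identityˡ : ∀ f → 𝟙 ⊛ f ≋ f
  ⊛-identityˡ f zero    = ≈-trans (+-identityʳ _) (*-identityˡ _)
  ⊛-identityˡ f (suc n) = ≈-trans (+-cong (*-identityˡ _) (⊛-zeroˡ f n)) (+-identityʳ _)

  t⊛-⊛ : ∀ f g → (t⊛ f) ⊛ g ≋ t⊛ (f ⊛ g)
  t⊛-⊛ f g zero    = ≈-trans (+-identityʳ _) (zeroˡ _)
  t⊛-⊛ f g (suc n) = ≈-trans (+-congʳ (zeroˡ _)) (+-identityˡ _)

  -- This is the linear term `a t`, used in the factor `1 + b t` and on the right-hand side of the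
  -- Euler equation.
  monomial : Carrier → Series
  monomial a = t⊛ (a · 𝟙)

  monomial-⊛ : ∀ a f → monomial a ⊛ f ≋ t⊛ (a · f)
  monomial-⊛ a f zero    = t⊛-⊛ (a · 𝟙) f zero
  monomial-⊛ a f (suc n) = begin
    (monomial a ⊛ f) (suc n)  ≈⟨ t⊛-⊛ (a · 𝟙) f (suc n) ⟩
    ((a · 𝟙) ⊛ f) n           ≈⟨ ·-⊛ a 𝟙 f n ⟩
    a * (𝟙 ⊛ f) n             ≈⟨ *-congˡ (⊛-identityˡ f n) ⟩
    a * f n                   ∎

  commutativeRing : CommutativeRing c ℓ
  commutativeRing = record
    { _≈_ = _≋_
    ; _+_ = _⊕_
    ; _*_ = _⊛_
    ; -_  = λ f n → - f n
    ; 0#  = λ _ → 0#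
    ; 1#  = 𝟙
    ; isCommutativeRing = record
      { isRing = record
        { +-isAbelianGroup = Pointwise.isAbelianGroup ℕ +-isAbelianGroup
        ; *-cong     = λ {f} {f′} {g} {g′} → ⊛-cong f f′ g g′
        ; *-assoc    = ⊛-assoc
        ; *-identity = ⊛-identityˡ , λ f n → ≈-trans (⊛-comm f 𝟙 n) (⊛-identityˡ f n)
        ; distrib    = (λ f g h n → ≈-trans (⊛-comm f (g ⊕ h) n) (≈-trans (⊛-distribʳ f g h n)
                         (+-cong (⊛-comm g f n) (⊛-comm h f n))))
                     , ⊛-distribʳ
        }
      ; *-comm = ⊛-comm
      }
    }

-- Two identities in an abstract commutative ring, to be applied to power series.

module RingLemmas (R : CommutativeRing c ℓ) where

  open CommutativeRing R renaming (refl to ≈-refl; sym to ≈-sym; trans to ≈-trans)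
  open SemiringSolver commutativeSemiring using (solve; _:+_; _:*_; _:=_)
  open RingProperties ring using (x[y-z]≈xy-xz; [y-z]x≈yx-zx)
  open SetoidReasoning setoid

  -- Logarithmic derivatives add under products: with `f′` and `g′` read as derivatives, the
  -- hypotheses say that those of `f` and `g` are `u / p` and `v / p`.
  leibniz-combine : ∀ {p u v f f′ g g′} → p * f′ ≈ u * f → p * g′ ≈ v * g →
                    p * (f′ * g + f * g′) ≈ (u + v) * (f * g)
  leibniz-combine {p} {u} {v} {f} {f′} {g} {g′} hf hg = begin
    p * (f′ * g + f * g′)
      ≈⟨ solve 5 (λ p f f′ g g′ → p :* (f′ :* g :+ f :* g′) := (p :* f′) :* g :+ f :* (p :* g′))
           ≈-refl p f f′ g g′ ⟩
    (p * f′) * g + f * (p * g′)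
      ≈⟨ +-cong (*-congʳ hf) (*-congˡ hg) ⟩
    (u * f) * g + f * (v * g)
      ≈⟨ solve 4 (λ u v f g → (u :* f) :* g :+ f :* (v :* g) := (u :+ v) :* (f :* g))
           ≈-refl u v f g ⟩
    (u + v) * (f * g) ∎

  -- Pulling out `f * g` leaves `q * (d - 1#)`. In the application `q` is t/(exp 1 - 1), `d` is exp
  -- 1, `τ` is t, and `f`, `f′` are the exponentials at x and x + 1.
  difference-factor : ∀ {q d τ f f′ g} → f′ ≈ f * d → q * (d - 1#) ≈ τ →
                      q * f′ * g - q * f * g ≈ τ * (f * g)
  difference-factor {q} {d} {τ} {f} {f′} {g} hf hq = begin
    q * f′ * g - q * f * g                     ≈⟨ +-cong shifted (-‿cong unshifted) ⟩
    (q * d) * (f * g) - (q * 1#) * (f * g)     ≈⟨ [y-z]x≈yx-zx (f * g) (q * d) (q * 1#) ⟨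
    (q * d - q * 1#) * (f * g)                 ≈⟨ *-congʳ (x[y-z]≈xy-xz q d 1#) ⟨
    q * (d - 1#) * (f * g)                     ≈⟨ *-congʳ hq ⟩
    τ * (f * g)                                ∎
    where
    shifted : q * f′ * g ≈ (q * d) * (f * g)
    shifted = ≈-trans (*-congʳ (*-congˡ hf))
      (solve 4 (λ q d f g → q :* (f :* d) :* g := (q :* d) :* (f :* g)) ≈-refl q d f g)
    unshifted : q * f * g ≈ (q * 1#) * (f * g)
    unshifted = ≈-trans (*-assoc q f g) (*-congʳ (≈-sym (*-identityʳ q)))

-- Natural numbers and their reciprocals among the rationals.

fromℚᵘ-homo-+ : ∀ p q → ℚ.fromℚᵘ p ℚ.+ ℚ.fromℚᵘ q ≡ ℚ.fromℚᵘ (p ℚᵘ.+ q)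
fromℚᵘ-homo-+ p q = ℚ.toℚᵘ-injective (begin
  ℚ.toℚᵘ (ℚ.fromℚᵘ p ℚ.+ ℚ.fromℚᵘ q)                 ≈⟨ ℚ.toℚᵘ-homo-+ (ℚ.fromℚᵘ p) (ℚ.fromℚᵘ q) ⟩
  ℚ.toℚᵘ (ℚ.fromℚᵘ p) ℚᵘ.+ ℚ.toℚᵘ (ℚ.fromℚᵘ q)       ≈⟨ ℚᵘ.+-cong (ℚ.toℚᵘ-fromℚᵘ p) (ℚ.toℚᵘ-fromℚᵘ q) ⟩
  p ℚᵘ.+ q                                           ≈⟨ ℚ.toℚᵘ-fromℚᵘ (p ℚᵘ.+ q) ⟨
  ℚ.toℚᵘ (ℚ.fromℚᵘ (p ℚᵘ.+ q))                       ∎)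
  where open SetoidReasoning ℚᵘ.≃-setoid

fromℚᵘ-homo-* : ∀ p q → ℚ.fromℚᵘ p ℚ.* ℚ.fromℚᵘ q ≡ ℚ.fromℚᵘ (p ℚᵘ.* q)
fromℚᵘ-homo-* p q = ℚ.toℚᵘ-injective (begin
  ℚ.toℚᵘ (ℚ.fromℚᵘ p ℚ.* ℚ.fromℚᵘ q)                 ≈⟨ ℚ.toℚᵘ-homo-* (ℚ.fromℚᵘ p) (ℚ.fromℚᵘ q) ⟩
  ℚ.toℚᵘ (ℚ.fromℚᵘ p) ℚᵘ.* ℚ.toℚᵘ (ℚ.fromℚᵘ q)       ≈⟨ ℚᵘ.*-cong (ℚ.toℚᵘ-fromℚᵘ p) (ℚ.toℚᵘ-fromℚᵘ q) ⟩
  p ℚᵘ.* q                                           ≈⟨ ℚ.toℚᵘ-fromℚᵘ (p ℚᵘ.* q) ⟨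
  ℚ.toℚᵘ (ℚ.fromℚᵘ (p ℚᵘ.* q))                       ∎)
  where open SetoidReasoning ℚᵘ.≃-setoid

-- Normalising a fraction involves a gcd that does not reduce for a variable `n`, so the sum is
-- formed among unnormalised fractions. There its numerator is `1 * 1 + n * 1`, and only `n * 1`
-- remains to be simplified.
fromℕ-suc : ∀ n → 1ℚ ℚ.+ (ℤ.+ n ℚ./ 1) ≡ ℤ.+ suc n ℚ./ 1
fromℕ-suc n = trans (fromℚᵘ-homo-+ ℚᵘ.1ℚᵘ (mkℚᵘ (ℤ.+ n) 0))
  (cong (λ i → ℚ.fromℚᵘ (mkℚᵘ (ℤ.+ 1 ℤ.+ i) 0)) (ℤ.*-identityʳ (ℤ.+ n)))

fromℕ-* : ∀ m n → (ℤ.+ m ℚ./ 1) ℚ.* (ℤ.+ n ℚ./ 1) ≡ ℤ.+ (m ℕ.* n) ℚ./ 1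
fromℕ-* m n = trans (fromℚᵘ-homo-* (mkℚᵘ (ℤ.+ m) 0) (mkℚᵘ (ℤ.+ n) 0))
  (cong (λ i → ℚ.fromℚᵘ (mkℚᵘ i 0)) (sym (ℤ.pos-* m n)))

fromℕ-inverse : ∀ n .{{_ : ℕ.NonZero n}} → (ℤ.+ 1 ℚ./ n) ℚ.* (ℤ.+ n ℚ./ 1) ≡ 1ℚ
fromℕ-inverse (suc n) = trans (fromℚᵘ-homo-* (mkℚᵘ (ℤ.+ 1) n) (mkℚᵘ (ℤ.+ suc n) 0))
  (ℚ.fromℚᵘ-cong {mkℚᵘ (ℤ.+ 1) n ℚᵘ.* mkℚᵘ (ℤ.+ suc n) 0} {ℚᵘ.1ℚᵘ}
    -- After cross-multiplication the claim is `(1 * (n + 1)) * 1 = 1 * ((n + 1) * 1)`, an instance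
    -- of associativity.
    (*≡* (ℤ.*-assoc (ℤ.+ 1) (ℤ.+ suc n) (ℤ.+ 1))))

open import Defs

open PowerSeriesProperties ℂ-commutativeRing
open CommutativeRing ℂ-commutativeRing using
  ( setoid; ring; commutativeSemiring
  ; +-cong; +-congˡ; +-congʳ; +-identityˡ; +-identityʳ; +-assoc; -‿inverseˡ
  ; *-cong; *-congˡ; *-congʳ; *-identityˡ; *-identityʳ; *-comm; *-assoc; distribʳ; zeroˡ; zeroʳ
  ) renaming (refl to ≈-refl; sym to ≈-sym; trans to ≈-trans)
open RingProperties ring using (x[y-z]≈xy-xz; +-cancelʳ)
open SemiringSolver commutativeSemiring using (solve; _:+_; _:*_; _:=_)
open SetoidReasoning setoid

module 𝕊 where
  open CommutativeRing commutativeRing public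
  open RingLemmas commutativeRing public

-- Embeddings into the complex numbers and inverses of positive integers.

ofℚ-cong : ∀ {p q} → p ≡ q → ofℚ p ≈ᶜ ofℚ q
ofℚ-cong refl = ≈-refl

opaque
  unfolding fromℚ _+ᶜ_

  -- Once the operations are unfolded, the representing Cauchy sequences agree term by term by
  -- computation.
  ofℝ-+ : ∀ x y → ofℝ (x +ᴿ y) ≈ᶜ ofℝ x +ᶜ ofℝ y
  ofℝ-+ x y = ≈ᴿ-refl +i≈ ≗⇒≈ᴿ (λ _ → refl)

  ofℚ-+ : ∀ p q → ofℚ (p ℚ.+ q) ≈ᶜ ofℚ p +ᶜ ofℚ q
  ofℚ-+ p q = ≗⇒≈ᴿ (λ _ → refl) +i≈ ≗⇒≈ᴿ (λ _ → refl)

  ofℚ-* : ∀ p q → ofℚ (p ℚ.* q) ≈ᶜ ofℚ p *ᶜ ofℚ q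
  ofℚ-* p q = ≈-trans (≗⇒≈ᴿ (λ _ → refl) +i≈ ≈ᴿ-refl) (≈-sym (ofℝ-* (fromℚ p) (fromℚ q)))

ofℕ-suc : ∀ n → ofℕ (suc n) ≈ᶜ 1ᶜ +ᶜ ofℕ n
ofℕ-suc n = ≈-trans (ofℚ-cong (sym (fromℕ-suc n))) (ofℚ-+ 1ℚ (ℤ.+ n ℚ./ 1))

ofℕ-* : ∀ m n → ofℕ (m ℕ.* n) ≈ᶜ ofℕ m *ᶜ ofℕ n
ofℕ-* m n = ≈-trans (ofℚ-cong (sym (fromℕ-* m n))) (ofℚ-* (ℤ.+ m ℚ./ 1) (ℤ.+ n ℚ./ 1))

1/ofℕ-inverse : ∀ n .{{_ : ℕ.NonZero n}} → 1/ofℕ n *ᶜ ofℕ n ≈ᶜ 1ᶜ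
1/ofℕ-inverse n =
  ≈-trans (≈-sym (ofℚ-* (ℤ.+ 1 ℚ./ n) (ℤ.+ n ℚ./ 1))) (ofℚ-cong (fromℕ-inverse n))

1/ofℕ-cancel : ∀ n .{{_ : ℕ.NonZero n}} z → 1/ofℕ n *ᶜ (ofℕ n *ᶜ z) ≈ᶜ z
1/ofℕ-cancel n z = ≈-trans (≈-sym (*-assoc _ _ _))
  (≈-trans (*-congʳ (1/ofℕ-inverse n)) (*-identityˡ z))

1/factorial-suc : ∀ n →
  ofℕ (suc n) *ᶜ 1/ofℕ (suc n !) {{suc n !≢0}} ≈ᶜ 1/ofℕ (n !) {{n !≢0}}
1/factorial-suc n = begin
  s *ᶜ i′                    ≈⟨ *-identityˡ _ ⟨
  -- Inserting `1 = i m` lets `s m` combine to `(n + 1)!`, which `i′` cancels.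
  1ᶜ *ᶜ (s *ᶜ i′)            ≈⟨ *-congʳ (1/ofℕ-inverse (n !) {{n !≢0}}) ⟨
  (i *ᶜ m) *ᶜ (s *ᶜ i′)      ≈⟨ solve 4 (λ i m s i′ → (i :* m) :* (s :* i′) := i :* (i′ :* (s :* m)))
                                  ≈-refl i m s i′ ⟩
  i *ᶜ (i′ *ᶜ (s *ᶜ m))      ≈⟨ *-congˡ (*-congˡ (ofℕ-* (suc n) (n !))) ⟨
  i *ᶜ (i′ *ᶜ ofℕ (suc n !)) ≈⟨ *-congˡ (1/ofℕ-inverse (suc n !) {{suc n !≢0}}) ⟩
  i *ᶜ 1ᶜ                    ≈⟨ *-identityʳ i ⟩
  i                          ∎
  where
  s = ofℕ (suc n)
  m = ofℕ (n !)
  i = 1/ofℕ (n !) {{n !≢0}}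
  i′ = 1/ofℕ (suc n !) {{suc n !≢0}}

ofℕ-suc-* : ∀ n z → ofℕ (suc n) *ᶜ z ≈ᶜ z +ᶜ ofℕ n *ᶜ z
ofℕ-suc-* n z = begin
  ofℕ (suc n) *ᶜ z        ≈⟨ *-congʳ (ofℕ-suc n) ⟩
  (1ᶜ +ᶜ ofℕ n) *ᶜ z      ≈⟨ distribʳ z 1ᶜ (ofℕ n) ⟩
  1ᶜ *ᶜ z +ᶜ ofℕ n *ᶜ z   ≈⟨ +-congʳ (*-identityˡ z) ⟩
  z +ᶜ ofℕ n *ᶜ z         ∎

-- The Euler operator and the differential equation of the binomial series.

-- t d/dt
θ : Series → Series
θ f n = ofℕ n *ᶜ f n

-- Weighting coefficients by their degree is a derivation because degrees add under multiplication.
θ-⊛ : ∀ f g → θ (f ⊛ g) ≋ θ f ⊛ g ⊕ f ⊛ θ g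
θ-⊛ f g zero = begin
  0ᶜ *ᶜ (f 0 *ᶜ g 0 +ᶜ 0ᶜ)                              ≈⟨ zeroˡ _ ⟩
  0ᶜ                                                    ≈⟨ +-identityˡ 0ᶜ ⟨
  0ᶜ +ᶜ 0ᶜ                                              ≈⟨ +-cong (+-identityʳ 0ᶜ) (+-identityʳ 0ᶜ) ⟨
  (0ᶜ +ᶜ 0ᶜ) +ᶜ (0ᶜ +ᶜ 0ᶜ)                              ≈⟨ +-cong (+-congʳ left) (+-congʳ right) ⟨
  (0ᶜ *ᶜ f 0 *ᶜ g 0 +ᶜ 0ᶜ) +ᶜ (f 0 *ᶜ (0ᶜ *ᶜ g 0) +ᶜ 0ᶜ) ∎
  where
  left : 0ᶜ *ᶜ f 0 *ᶜ g 0 ≈ᶜ 0ᶜ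
  left = ≈-trans (*-congʳ (zeroˡ _)) (zeroˡ _)
  right : f 0 *ᶜ (0ᶜ *ᶜ g 0) ≈ᶜ 0ᶜ
  right = ≈-trans (*-congˡ (zeroˡ _)) (zeroʳ _)
θ-⊛ f g (suc n) = begin
  s *ᶜ (f 0 *ᶜ g (suc n) +ᶜ P)
    ≈⟨ solve 4 (λ s a b p → s :* (a :* b :+ p) := a :* (s :* b) :+ s :* p)
         ≈-refl s (f 0) (g (suc n)) P ⟩
  A +ᶜ s *ᶜ P
    ≈⟨ +-congˡ (ofℕ-suc-* n P) ⟩
  A +ᶜ (P +ᶜ θ (tail f ⊛ g) n)
    ≈⟨ +-congˡ (+-congˡ (θ-⊛ (tail f) g n)) ⟩
  A +ᶜ (P +ᶜ (X +ᶜ Y))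
    ≈⟨ solve 4 (λ a p x y → a :+ (p :+ (x :+ y)) := (p :+ x) :+ (a :+ y)) ≈-refl A P X Y ⟩
  (P +ᶜ X) +ᶜ (A +ᶜ Y)
    ≈⟨ +-congʳ (⊛-distribʳ g (tail f) (θ (tail f)) n) ⟨
  ((tail f ⊕ θ (tail f)) ⊛ g) n +ᶜ (A +ᶜ Y)
    -- Index `k` of `tail (θ f)` carries the weight `k + 1`, so this series is
    -- `tail f ⊕ θ (tail f)`; this absorbs the extra `P` produced by `s = 1 + n`.
    ≈⟨ +-congʳ (⊛-cong (tail (θ f)) (tail f ⊕ θ (tail f)) g g (λ k → ofℕ-suc-* k (f (suc k))) (λ _ → ≈-refl) n) ⟨
  (tail (θ f) ⊛ g) n +ᶜ (A +ᶜ Y)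
    ≈⟨ +-congʳ (+-identityˡ _) ⟨
  (0ᶜ +ᶜ (tail (θ f) ⊛ g) n) +ᶜ (A +ᶜ Y)
    -- The constant coefficient of `θ f` is zero, so its term may be added to complete the
    -- convolution.
    ≈⟨ +-congʳ (+-congʳ (≈-trans (*-congʳ (zeroˡ _)) (zeroˡ _))) ⟨
  (0ᶜ *ᶜ f 0 *ᶜ g (suc n) +ᶜ (tail (θ f) ⊛ g) n) +ᶜ (A +ᶜ Y) ∎
  where
  s = ofℕ (suc n)
  P = (tail f ⊛ g) n
  A = f 0 *ᶜ (s *ᶜ g (suc n))
  X = (θ (tail f) ⊛ g) n
  Y = (tail f ⊛ θ g) n

-- Multiplication by `n + 1` turns `1 / (n + 1)!` into `1 / n!`, and adding `n` to the last factor
-- `a - n` of the falling factorial leaves `a`. This is (1 + t) F′ = a F for F = (1 + t)^a, read off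
-- in degree `n`.
binomial-suc : ∀ a n →
  ofℕ (suc n) *ᶜ binomial a (suc n) +ᶜ ofℕ n *ᶜ binomial a n ≈ᶜ a *ᶜ binomial a n
binomial-suc a n = begin
  s *ᶜ (f *ᶜ d *ᶜ i′) +ᶜ m *ᶜ (f *ᶜ i)
    ≈⟨ solve 6 (λ s f d i′ m i → s :* (f :* d :* i′) :+ m :* (f :* i)
                  := (s :* i′) :* (f :* d) :+ m :* (f :* i)) ≈-refl s f d i′ m i ⟩
  (s *ᶜ i′) *ᶜ (f *ᶜ d) +ᶜ m *ᶜ (f *ᶜ i)
    ≈⟨ +-congʳ (*-congʳ (1/factorial-suc n)) ⟩
  i *ᶜ (f *ᶜ d) +ᶜ m *ᶜ (f *ᶜ i)
    ≈⟨ solve 4 (λ f d m i → i :* (f :* d) :+ m :* (f :* i) := (d :+ m) :* (f :* i))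
         ≈-refl f d m i ⟩
  (d +ᶜ m) *ᶜ (f *ᶜ i)
    ≈⟨ *-congʳ (≈-trans (+-assoc a (-ᶜ m) m)
         (≈-trans (+-congˡ (-‿inverseˡ m)) (+-identityʳ a))) ⟩
  a *ᶜ (f *ᶜ i) ∎
  where
  s = ofℕ (suc n)
  m = ofℕ n
  f = fallingFactorial a n
  d = a -ᶜ m
  i = 1/ofℕ (n !) {{n !≢0}}
  i′ = 1/ofℕ (suc n !) {{suc n !≢0}}

-- (1 + b t) f′ = a f, multiplied by t so that no shift of indices occurs.
EulerEquation : (b a : ℂ) → Series → Set
EulerEquation b a f = (𝟙 ⊕ monomial b) ⊛ θ f ≋ monomial a ⊛ f

[1+bt]-⊛-suc : ∀ b f n → ((𝟙 ⊕ monomial b) ⊛ f) (suc n) ≈ᶜ f (suc n) +ᶜ b *ᶜ f n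
[1+bt]-⊛-suc b f n = ≈-trans (⊛-distribʳ f 𝟙 (monomial b) (suc n))
  (+-cong (⊛-identityˡ f (suc n)) (monomial-⊛ b f (suc n)))

-- In degree `n + 1` the equation is `binomial-suc` multiplied by the power `n + 1` of `b`.
binomialSeries-euler : ∀ b a → EulerEquation b (a *ᶜ b) ([1+ b t]^ a)
binomialSeries-euler b a zero = begin
  -- In degree 0 both sides vanish: `θ` kills the constant term and a monomial has none.
  (1ᶜ +ᶜ 0ᶜ) *ᶜ (0ᶜ *ᶜ ([1+ b t]^ a) 0) +ᶜ 0ᶜ  ≈⟨ +-congʳ (*-congˡ (zeroˡ _)) ⟩
  (1ᶜ +ᶜ 0ᶜ) *ᶜ 0ᶜ +ᶜ 0ᶜ                       ≈⟨ +-congʳ (zeroʳ _) ⟩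
  0ᶜ +ᶜ 0ᶜ                                     ≈⟨ +-congʳ (zeroˡ _) ⟨
  0ᶜ *ᶜ ([1+ b t]^ a) 0 +ᶜ 0ᶜ                  ∎
binomialSeries-euler b a (suc n) = begin
  ((𝟙 ⊕ monomial b) ⊛ θ ([1+ b t]^ a)) (suc n)
    ≈⟨ [1+bt]-⊛-suc b (θ ([1+ b t]^ a)) n ⟩
  s *ᶜ (β′ *ᶜ (b *ᶜ p)) +ᶜ b *ᶜ (m *ᶜ (β *ᶜ p))
    ≈⟨ solve 6 (λ s β′ b p m β → s :* (β′ :* (b :* p)) :+ b :* (m :* (β :* p))
                  := (s :* β′ :+ m :* β) :* (b :* p)) ≈-refl s β′ b p m β ⟩
  (s *ᶜ β′ +ᶜ m *ᶜ β) *ᶜ (b *ᶜ p)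
    ≈⟨ *-congʳ (binomial-suc a n) ⟩
  (a *ᶜ β) *ᶜ (b *ᶜ p)
    ≈⟨ solve 4 (λ a β b p → (a :* β) :* (b :* p) := (a :* b) :* (β :* p)) ≈-refl a β b p ⟩
  (a *ᶜ b) *ᶜ (β *ᶜ p)
    ≈⟨ monomial-⊛ (a *ᶜ b) ([1+ b t]^ a) (suc n) ⟨
  (monomial (a *ᶜ b) ⊛ [1+ b t]^ a) (suc n) ∎
  where
  s = ofℕ (suc n)
  m = ofℕ n
  β = binomial a n
  β′ = binomial a (suc n)
  p = b ^ᶜ n

-- In degree `n + 1` the equation expresses `(n + 1) f (n + 1)` through `f n`, and `n + 1` is
-- invertible, so the constant term fixes every coefficient.
euler-unique : ∀ {b a f g} → EulerEquation b a f → EulerEquation b a g →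
               f 0 ≈ᶜ g 0 → f ≋ g
euler-unique ef eg f₀≈g₀ zero = f₀≈g₀
euler-unique {b} {a} {f} {g} ef eg f₀≈g₀ (suc n) = begin
  f (suc n)                                    ≈⟨ 1/ofℕ-cancel (suc n) (f (suc n)) ⟨
  1/ofℕ (suc n) *ᶜ (ofℕ (suc n) *ᶜ f (suc n))  ≈⟨ *-congˡ (+-cancelʳ (b *ᶜ (ofℕ n *ᶜ f n)) _ _ step) ⟩
  1/ofℕ (suc n) *ᶜ (ofℕ (suc n) *ᶜ g (suc n))  ≈⟨ 1/ofℕ-cancel (suc n) (g (suc n)) ⟩
  g (suc n)                                    ∎
  where
  ih : f n ≈ᶜ g n
  ih = euler-unique {b} {a} {f} {g} ef eg f₀≈g₀ n
  recurrence : ∀ h → EulerEquation b a h →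
               ofℕ (suc n) *ᶜ h (suc n) +ᶜ b *ᶜ (ofℕ n *ᶜ h n) ≈ᶜ a *ᶜ h n
  recurrence h eh = ≈-trans (≈-sym ([1+bt]-⊛-suc b (θ h) n))
    (≈-trans (eh (suc n)) (monomial-⊛ a h (suc n)))
  step : ofℕ (suc n) *ᶜ f (suc n) +ᶜ b *ᶜ (ofℕ n *ᶜ f n)
      ≈ᶜ ofℕ (suc n) *ᶜ g (suc n) +ᶜ b *ᶜ (ofℕ n *ᶜ f n)
  step = begin
    ofℕ (suc n) *ᶜ f (suc n) +ᶜ b *ᶜ (ofℕ n *ᶜ f n)  ≈⟨ recurrence f ef ⟩
    a *ᶜ f n                                         ≈⟨ *-congˡ ih ⟩
    a *ᶜ g n                                         ≈⟨ recurrence g eg ⟨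
    ofℕ (suc n) *ᶜ g (suc n) +ᶜ b *ᶜ (ofℕ n *ᶜ g n)  ≈⟨ +-congˡ (*-congˡ (*-congˡ ih)) ⟨
    ofℕ (suc n) *ᶜ g (suc n) +ᶜ b *ᶜ (ofℕ n *ᶜ f n)  ∎

-- The addition law for exponents of binomial series.

monomial-+ : ∀ a b → monomial (a +ᶜ b) ≋ monomial a ⊕ monomial b
monomial-+ a b zero    = ≈-sym (+-identityʳ 0ᶜ)
monomial-+ a b (suc n) = distribʳ (𝟙 n) a b

monomial-cong : ∀ {a b} → a ≈ᶜ b → monomial a ≋ monomial b
monomial-cong a≈b zero    = ≈-refl
monomial-cong a≈b (suc n) = *-congʳ a≈b

-- The product rule for `θ` reduces this to adding logarithmic derivatives over the common
-- denominator `1 + b t`.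
euler-⊛ : ∀ {b a a′ f g} → EulerEquation b a f → EulerEquation b a′ g →
          EulerEquation b (a +ᶜ a′) (f ⊛ g)
euler-⊛ {b} {a} {a′} {f} {g} ef eg n = begin
  ((𝟙 ⊕ monomial b) ⊛ θ (f ⊛ g)) n
    ≈⟨ ⊛-cong (𝟙 ⊕ monomial b) (𝟙 ⊕ monomial b) (θ (f ⊛ g)) (θ f ⊛ g ⊕ f ⊛ θ g)
         (λ _ → ≈-refl) (θ-⊛ f g) n ⟩
  ((𝟙 ⊕ monomial b) ⊛ (θ f ⊛ g ⊕ f ⊛ θ g)) n
    ≈⟨ 𝕊.leibniz-combine {𝟙 ⊕ monomial b} {monomial a} {monomial a′} {f} {θ f} {g} {θ g} ef eg n ⟩
  ((monomial a ⊕ monomial a′) ⊛ (f ⊛ g)) n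
    ≈⟨ ⊛-cong (monomial (a +ᶜ a′)) (monomial a ⊕ monomial a′) (f ⊛ g) (f ⊛ g)
         (monomial-+ a a′) (λ _ → ≈-refl) n ⟨
  (monomial (a +ᶜ a′) ⊛ (f ⊛ g)) n ∎

binomialSeries-constant : ∀ b a → ([1+ b t]^ a) 0 ≈ᶜ 1ᶜ
binomialSeries-constant b a = ≈-trans (*-identityʳ _) (*-identityʳ _)

-- The exponent `c` is kept separate because `(x + 1) / lam` agrees with `x / lam + 1 / lam` only up
-- to `≈ᶜ`.
binomialSeries-+ : ∀ b {c a a′} → c ≈ᶜ a +ᶜ a′ →
                   [1+ b t]^ c ≋ ([1+ b t]^ a) ⊛ ([1+ b t]^ a′)
binomialSeries-+ b {c} {a} {a′} c≈ =
  euler-unique {b} {a *ᶜ b +ᶜ a′ *ᶜ b} {[1+ b t]^ c} {([1+ b t]^ a) ⊛ ([1+ b t]^ a′)}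
    (λ n → ≈-trans (binomialSeries-euler b c n)
      (⊛-cong (monomial (c *ᶜ b)) (monomial (a *ᶜ b +ᶜ a′ *ᶜ b)) ([1+ b t]^ c) ([1+ b t]^ c)
        (monomial-cong (≈-trans (*-congʳ c≈) (distribʳ b a a′))) (λ _ → ≈-refl) n))
    (euler-⊛ {b} {a *ᶜ b} {a′ *ᶜ b} {[1+ b t]^ a} {[1+ b t]^ a′}
      (binomialSeries-euler b a) (binomialSeries-euler b a′))
    (begin
      ([1+ b t]^ c) 0
        ≈⟨ binomialSeries-constant b c ⟩
      1ᶜ
        ≈⟨ *-identityʳ 1ᶜ ⟨
      1ᶜ *ᶜ 1ᶜ
        ≈⟨ *-cong (binomialSeries-constant b a) (binomialSeries-constant b a′) ⟨
      ([1+ b t]^ a) 0 *ᶜ ([1+ b t]^ a′) 0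
        ≈⟨ +-identityʳ _ ⟨
      (([1+ b t]^ a) ⊛ ([1+ b t]^ a′)) 0 ∎)

-- Differences of degenerate Bernoulli polynomials.

module _ (lam : ℝ) (lam#0 : lam #ᴿ 0ᴿ) where

  open Degenerate lam lam#0

  exp-+1 : ∀ x → exp (ofℝ (x +ᴿ 1ᴿ)) ≋ exp (ofℝ x) ⊛ exp 1ᶜ
  exp-+1 x = binomialSeries-+ (ofℝ lam)
    (≈-trans (*-congʳ (ofℝ-+ x 1ᴿ)) (distribʳ _ (ofℝ x) 1ᶜ))

  -- The arbitrary series `h` lets one proof serve both the cosine and the sine case.
  bernoulli-difference : ∀ x h n →
    (t/[exp-1] ⊛ exp (ofℝ (x +ᴿ 1ᴿ)) ⊛ h) (suc n) -ᶜ (t/[exp-1] ⊛ exp (ofℝ x) ⊛ h) (suc n)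
      ≈ᶜ (exp (ofℝ x) ⊛ h) n
  bernoulli-difference x h n = ≈-trans
    (𝕊.difference-factor {t/[exp-1]} {exp 1ᶜ} {t⊛ 𝟙} {exp (ofℝ x)} {exp (ofℝ (x +ᴿ 1ᴿ))} {h}
      (exp-+1 x) t/[exp-1]-⊛ (suc n))
    -- The remaining factor t shifts the degree from `suc n` down to `n`.
    (≈-trans (t⊛-⊛ 𝟙 (exp (ofℝ x) ⊛ h) (suc n)) (⊛-identityˡ (exp (ofℝ x) ⊛ h) n))

  -- The shift in degree changes the weight `n !` to `suc n !`; the quotient `suc n` of the two is
  -- what the prefactor cancels.
  egf-bernoulli-difference : ∀ x h n →
    egfCoefficient (exp (ofℝ x) ⊛ h) n
      ≈ᶜ 1/ofℕ (suc n) *ᶜ (egfCoefficient (t/[exp-1] ⊛ exp (ofℝ (x +ᴿ 1ᴿ)) ⊛ h) (suc n)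
                          -ᶜ egfCoefficient (t/[exp-1] ⊛ exp (ofℝ x) ⊛ h) (suc n))
  egf-bernoulli-difference x h n = begin
    ofℕ (n !) *ᶜ F
      ≈⟨ 1/ofℕ-cancel (suc n) (ofℕ (n !) *ᶜ F) ⟨
    1/ofℕ (suc n) *ᶜ (ofℕ (suc n) *ᶜ (ofℕ (n !) *ᶜ F))
      ≈⟨ *-congˡ (*-assoc (ofℕ (suc n)) (ofℕ (n !)) F) ⟨
    1/ofℕ (suc n) *ᶜ (ofℕ (suc n) *ᶜ ofℕ (n !) *ᶜ F)
      ≈⟨ *-congˡ (*-cong (ofℕ-* (suc n) (n !)) (bernoulli-difference x h n)) ⟨
    1/ofℕ (suc n) *ᶜ (ofℕ (suc n !) *ᶜ (B′ -ᶜ B))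
      ≈⟨ *-congˡ (x[y-z]≈xy-xz (ofℕ (suc n !)) B′ B) ⟩
    1/ofℕ (suc n) *ᶜ (ofℕ (suc n !) *ᶜ B′ -ᶜ ofℕ (suc n !) *ᶜ B) ∎
    where
    F = (exp (ofℝ x) ⊛ h) n
    B′ = (t/[exp-1] ⊛ exp (ofℝ (x +ᴿ 1ᴿ)) ⊛ h) (suc n)
    B = (t/[exp-1] ⊛ exp (ofℝ x) ⊛ h) (suc n)

theorem3p3 : (lam : ℝ) (lam#0 : lam #ᴿ 0ᴿ) (x y : ℝ) (n : ℕ) →
    let open Degenerate lam lam#0 in
    (C n x y ≈ᶜ 1/ofℕ (suc n) *ᶜ (βᶜ (suc n) (x +ᴿ 1ᴿ) y -ᶜ βᶜ (suc n) x y))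
    × (S n x y ≈ᶜ 1/ofℕ (suc n) *ᶜ (βˢ (suc n) (x +ᴿ 1ᴿ) y -ᶜ βˢ (suc n) x y))
theorem3p3 lam lam#0 x y n =
    egf-bernoulli-difference lam lam#0 x (cos y) n
  , egf-bernoulli-difference lam lam#0 x (sin y) n
  where open Degenerate lam lam#0
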